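{- If a cube $A\in\mathcal{C}^3_3(v,k,\lambda)$ exists and $k$ is not divisible by $v$, then $$\lambda(v-1)\ge k\big(\lfloor k/v\rfloor+\lceil k/v\rceil-1\big)-v\lfloor k/v\rfloor\lceil k/v\rceil .$$ Equality holds if and only if every row-sum of $A$ is either $\lfloor k/v\rfloor$ or $\lceil k/v\rceil$. In that case, in any layer and for either of the two directions of parallel rows in that layer, among the $v$ parallel rows the sum $\lfloor k/v\rfloor$ occurs $\lceil k/v\rceil v-k$ times and the sum $\lceil k/v\rceil$ occurs $k-\lfloor k/v\rfloor v$ times.
   Context: A $v\times v\times v$ array is a function on $\{1,\dots,v\}^3$. A layer is a 2-dimensional subarray obtained by fixing one of the three coordinates; a row is a 1-dimensional subarray obtained by fixing two of the three coordinates (any two), and its row-sum is the sum of its $v$ entries. Two layers are parallel if they fix the same coordinate, to different values; their scalar product is the sum over all positions of the product of corresponding entries. $\mathcal{C}^3_3(v,k,\lambda)$ is the set of $v\times v\times v$ arrays over $\{0,1\}$ such that every layer (in each of the three directions) contains exactly $k$ ones and every two parallel layers have scalar product $\lambda$. -}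

module Defs where

import Algebra.Properties.Semiring.Sum
open import Data.Fin using (Fin; zero; suc)
open import Data.Integer using (ℤ; +_; 0ℤ; 1ℤ; _*_; _≟_)
open import Data.Integer.Properties using (+-*-semiring)
open import Data.Nat using (ℕ)
import Data.Nat.Properties as ℕ
open import Data.Sum using (_⊎_)
open import Data.Vec using (count; tabulate)
open import Data.Vec.Functional using (Vector)
open import Function using (flip)
open import Relation.Binary.PropositionalEquality using (_≡_; _≢_)

module ℕΣ = Algebra.Properties.Semiring.Sum ℕ.+-*-semiring
module ℤΣ = Algebra.Properties.Semiring.Sum +-*-semiring

Array₂ : ℕ → Set
Array₂ v = Fin v → Fin v → ℤ

Array₃ : ℕ → Set
Array₃ v = Fin v → Fin v → Fin v → ℤ

-- The first argument selects which of the three coordinates is fixed, the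
-- third its value; the two remaining coordinates keep their order.
layer : ∀ {v} → Fin 3 → Array₃ v → Fin v → Array₂ v
layer zero             A i p q = A i p q
layer (suc zero)       A i p q = A p i q
layer (suc (suc zero)) A i p q = A p q i

-- The first argument selects the coordinate that varies; the other two are
-- fixed.
row : ∀ {v} → Fin 3 → Array₃ v → Fin v → Fin v → Vector ℤ v
row d A p q i = layer d A i p q

-- The two families of parallel rows of a layer.
rowsOfLayer : ∀ {v} → Fin 2 → Array₂ v → Fin v → Vector ℤ v
rowsOfLayer zero       M = M
rowsOfLayer (suc zero) M = flip M

rowSum : ∀ {v} → Vector ℤ v → ℤ
rowSum = ℤΣ.sum

scalarProduct : ∀ {v} → Array₂ v → Array₂ v → ℤ
scalarProduct M N = ℤΣ.sum λ p → ℤΣ.sum λ q → M p q * N p q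

occurrences : ∀ {n} → ℤ → Vector ℤ n → ℕ
occurrences x xs = count (_≟ x) (tabulate xs)

ones : ∀ {v} → Array₂ v → ℕ
ones M = ℕΣ.sum λ p → occurrences 1ℤ (M p)

record 𝒞³₃ (v k λ′ : ℕ) (A : Array₃ v) : Set where
  field
    binary  : ∀ i j l → A i j l ≡ 0ℤ ⊎ A i j l ≡ 1ℤ
    weight  : ∀ d i → ones (layer d A i) ≡ k
    product : ∀ d i j → i ≢ j →
              scalarProduct (layer d A i) (layer d A j) ≡ + λ′

-- Fix a direction and let r range over the v² row sums in that direction. Their
-- total is v k, and since r² expands into scalar products of layers, the sum of
-- the r² is v (k + (v - 1) λ). As ⌊k/v⌋ and ⌈k/v⌉ are consecutive integers,
-- (r - ⌊k/v⌋) (r - ⌈k/v⌉) is nonnegative and vanishes only when r is one of the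
-- two; summed over all rows it is v times the difference of the two sides.
module Submission where

open import Defs
open import Data.Fin using (Fin; zero; suc; punchIn)
open import Data.Fin.Properties using (punchInᵢ≢i)
open import Data.Integer
  using (ℤ; +_; +[1+_]; -[1+_]; 0ℤ; 1ℤ; _+_; _-_; -_; _*_; _≤_; _≥_; _≟_; +≤+)
open import Data.Integer.DivMod using (div-pos-is-/ℕ)
open import Data.Integer.Properties
  using ( pos-+; pos-*; +-comm; +-injective; +-mono-≤; ≤-refl; *-zeroʳ
        ; *-cancelˡ-≤-pos; *-cancelˡ-≡; i≢suc[i]
        ; i-j≡0⇒i≡j; i≡j⇒i-j≡0; 0≤i-j⇒j≤i; i*j≡0⇒i≡0∨j≡0)
open import Data.Integer.Tactic.RingSolver using (solve-∀)
open import Data.Nat as ℕ using (ℕ; NonZero; zero; suc)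
open import Data.Nat.Divisibility using (_∣_; _∣0; m%n≡0⇒n∣m)
import Data.Nat.Properties as ℕ
open import Data.Product using (_×_; _,_; proj₁; proj₂)
open import Data.Rational.Unnormalised using (_/_; floor; ceiling)
open import Data.Sum as Sum using (_⊎_; inj₁; inj₂)
open import Data.Vec.Functional using (Vector)
open import Function using (_∘_)
open import Function.Bundles using (_⇔_; mk⇔)
open import Relation.Binary.PropositionalEquality
  using (_≡_; _≢_; refl; sym; trans; cong; cong₂; subst; module ≡-Reasoning)
open import Relation.Nullary using (¬_; yes; no; contradiction)

open ℤΣ using (sum; sum-cong-≗; sum-remove; ∑-comm; ∑-distrib-+; *-distribˡ-sum; *-distribʳ-sum)
open ≡-Reasoning

-- Consecutive integers: the floor and ceiling of a fraction, and products.

ceiling≡floor+1 : ∀ k v .{{_ : NonZero v}} → ¬ (v ∣ k) → ⌈ + k / v ⌉ ≡ ⌊ + k / v ⌋ + 1ℤ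
ceiling≡floor+1 zero v v∤0 = contradiction (v ∣0) v∤0
ceiling≡floor+1 (suc m) v@(suc _) v∤k
  -- The ceiling is the negated floor of the negated fraction, so both signs of the numerator are
  -- divided. For a negative numerator, division rounds one further down exactly when the remainder
  -- is nonzero.
  rewrite div-pos-is-/ℕ +[1+ m ] v {{_}} | div-pos-is-/ℕ -[1+ m ] v {{_}}
  with suc m ℕ.% v in eq
... | zero  = contradiction (m%n≡0⇒n∣m (suc m) v eq) v∤k
... | suc _ = cong +_ (ℕ.+-comm 1 (suc m ℕ./ v))

-- No integer lies strictly between 0 and 1, so the two factors never have opposite signs.
consecutive-product-nonneg : ∀ y → 0ℤ ≤ y * (y - 1ℤ)
consecutive-product-nonneg (+ zero)  = +≤+ ℕ.z≤n
consecutive-product-nonneg +[1+ n ]  = subst (0ℤ ≤_) (pos-* (suc n) n) (+≤+ ℕ.z≤n)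
consecutive-product-nonneg -[1+ n ]  = +≤+ ℕ.z≤n

-- Finite sums of integers.

sum-const : ∀ n x → sum {n} (λ _ → x) ≡ + n * x
sum-const zero    x = refl
sum-const (suc n) x = begin
  x + sum {n} (λ _ → x)  ≡⟨ cong (λ z → x + z) (sum-const n x) ⟩
  x + + n * x            ≡⟨ lemma x (+ n) ⟩
  + suc n * x            ∎
  where
  lemma : ∀ x m → x + m * x ≡ (1ℤ + m) * x
  lemma = solve-∀

-- Fits the expansion of `(r - f) * (r - c)`, with `X` for the squares and `Y` for the row sums; it
-- is applied once along each line and once across the lines.
sum-affine : ∀ {n} (X Y : Vector ℤ n) a b →
             sum (λ p → X p + a * Y p + b) ≡ sum X + a * sum Y + + n * b
sum-affine {n} X Y a b = begin
  sum (λ p → X p + a * Y p + b)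
    ≡⟨ ∑-distrib-+ (λ p → X p + a * Y p) (λ _ → b) ⟩
  sum (λ p → X p + a * Y p) + sum {n} (λ _ → b)
    ≡⟨ cong₂ _+_ (∑-distrib-+ X (λ p → a * Y p)) (sum-const n b) ⟩
  sum X + sum (λ p → a * Y p) + + n * b
    ≡⟨ cong (λ z → sum X + z + + n * b) (*-distribˡ-sum a Y) ⟨
  sum X + a * sum Y + + n * b ∎

sum-nonneg : ∀ {n} (xs : Vector ℤ n) → (∀ i → 0ℤ ≤ xs i) → 0ℤ ≤ sum xs
sum-nonneg {zero}  xs xs≥0 = ≤-refl
sum-nonneg {suc n} xs xs≥0 = +-mono-≤ (xs≥0 zero) (sum-nonneg (xs ∘ suc) (xs≥0 ∘ suc))

nonneg-+-≡0 : ∀ {x y} → 0ℤ ≤ x → 0ℤ ≤ y → x + y ≡ 0ℤ → x ≡ 0ℤ × y ≡ 0ℤ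
nonneg-+-≡0 {+ m} {+ n} _ _ eq =
  cong +_ (ℕ.m+n≡0⇒m≡0 m (+-injective eq)) , cong +_ (ℕ.m+n≡0⇒n≡0 m (+-injective eq))

sum≡0⇒≡0 : ∀ {n} (xs : Vector ℤ n) → (∀ i → 0ℤ ≤ xs i) → sum xs ≡ 0ℤ → ∀ i → xs i ≡ 0ℤ
sum≡0⇒≡0 xs xs≥0 eq zero =
  proj₁ (nonneg-+-≡0 (xs≥0 zero) (sum-nonneg (xs ∘ suc) (xs≥0 ∘ suc)) eq)
sum≡0⇒≡0 xs xs≥0 eq (suc i) = sum≡0⇒≡0 (xs ∘ suc) (xs≥0 ∘ suc)
  (proj₂ (nonneg-+-≡0 (xs≥0 zero) (sum-nonneg (xs ∘ suc) (xs≥0 ∘ suc)) eq)) i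

pos-sum : ∀ {n} (xs : Vector ℕ n) → + ℕΣ.sum xs ≡ sum (+_ ∘ xs)
pos-sum {zero}  xs = refl
pos-sum {suc n} xs = trans (pos-+ (xs zero) _) (cong (λ z → + xs zero + z) (pos-sum (xs ∘ suc)))

-- Totals and bilinearity of the scalar product.

total : ∀ {v} → Array₂ v → ℤ
total M = sum λ p → sum λ q → M p q

total-cong : ∀ {v} {M N : Array₂ v} → (∀ p q → M p q ≡ N p q) → total M ≡ total N
total-cong M≗N = sum-cong-≗ λ p → sum-cong-≗ (M≗N p)

total-sum : ∀ {v n} (L : Fin n → Array₂ v) →
            total (λ p q → sum λ i → L i p q) ≡ sum λ i → total (L i)
total-sum L = trans (sum-cong-≗ λ p → ∑-comm (λ q i → L i p q))
                    (∑-comm λ p i → sum (L i p))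

scalarProduct-sumˡ : ∀ {v n} (L : Fin n → Array₂ v) N →
  scalarProduct (λ p q → sum λ i → L i p q) N ≡ sum λ i → scalarProduct (L i) N
scalarProduct-sumˡ L N = trans
  (total-cong λ p q → *-distribʳ-sum (N p q) (λ i → L i p q))
  (total-sum λ i p q → L i p q * N p q)

scalarProduct-sumʳ : ∀ {v n} M (L : Fin n → Array₂ v) →
  scalarProduct M (λ p q → sum λ i → L i p q) ≡ sum λ i → scalarProduct M (L i)
scalarProduct-sumʳ M L = trans
  (total-cong λ p q → *-distribˡ-sum (M p q) (λ i → L i p q))
  (total-sum λ i p q → M p q * L i p q)

-- Vectors with two consecutive values.

occurrences-hit : ∀ {n x} (xs : Vector ℤ (suc n)) → xs zero ≡ x →
                  occurrences x xs ≡ suc (occurrences x (xs ∘ suc))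
occurrences-hit {x = x} xs hit with xs zero ≟ x
... | yes _   = refl
... | no miss = contradiction hit miss

occurrences-miss : ∀ {n x} (xs : Vector ℤ (suc n)) → xs zero ≢ x →
                   occurrences x xs ≡ occurrences x (xs ∘ suc)
occurrences-miss {x = x} xs miss with xs zero ≟ x
... | yes hit = contradiction hit miss
... | no _    = refl

i≢i+1 : ∀ i → i ≢ i + 1ℤ
i≢i+1 i eq = i≢suc[i] (trans eq (+-comm i 1ℤ))

module _ (a : ℤ) where

  -- Since `a` and `a + 1ℤ` differ, each entry is counted by exactly one of the two terms.
  occurrences-length : ∀ {n} (xs : Vector ℤ n) →
    (∀ i → xs i ≡ a ⊎ xs i ≡ a + 1ℤ) →
    + occurrences a xs + + occurrences (a + 1ℤ) xs ≡ + n
  occurrences-length {zero}  xs two = refl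
  occurrences-length {suc n} xs two
    with ih ← occurrences-length (xs ∘ suc) (two ∘ suc) | two zero
  ... | inj₁ x≡a
    rewrite occurrences-hit xs x≡a
          | occurrences-miss xs (λ x≡a+1 → i≢i+1 a (trans (sym x≡a) x≡a+1))
    = cong (λ z → 1ℤ + z) ih
  ... | inj₂ x≡a+1
    rewrite occurrences-hit xs x≡a+1
          | occurrences-miss xs (λ x≡a → i≢i+1 a (trans (sym x≡a) x≡a+1))
    = trans (cong +_ (ℕ.+-suc _ _)) (cong (λ z → 1ℤ + z) ih)

  -- Every entry contributes `a`, and each entry equal to `a + 1ℤ` contributes one more.
  occurrences-sum : ∀ {n} (xs : Vector ℤ n) →
    (∀ i → xs i ≡ a ⊎ xs i ≡ a + 1ℤ) →
    sum xs ≡ + n * a + + occurrences (a + 1ℤ) xs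
  occurrences-sum {zero}  xs two = refl
  occurrences-sum {suc n} xs two
    with ih ← occurrences-sum (xs ∘ suc) (two ∘ suc) | two zero
  ... | inj₁ x≡a
    rewrite occurrences-miss xs (λ x≡a+1 → i≢i+1 a (trans (sym x≡a) x≡a+1))
    = trans (cong₂ _+_ x≡a ih) (lemma a (+ n) _)
    where
    lemma : ∀ a n o → a + (n * a + o) ≡ (1ℤ + n) * a + o
    lemma = solve-∀
  ... | inj₂ x≡a+1
    rewrite occurrences-hit xs x≡a+1
    = trans (cong₂ _+_ x≡a+1 ih) (lemma a (+ n) _)
    where
    lemma : ∀ a n o → a + 1ℤ + (n * a + o) ≡ (1ℤ + n) * a + (1ℤ + o)
    lemma = solve-∀

-- Layers, their ones and their rows.

total≡ones : ∀ {v} (M : Array₂ v) → (∀ p q → M p q ≡ 0ℤ ⊎ M p q ≡ 1ℤ) → total M ≡ + ones M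
total≡ones {v} M binary = begin
  total M                                       ≡⟨ sum-cong-≗ rowTotal ⟩
  sum (λ p → + occurrences 1ℤ (M p))            ≡⟨ pos-sum (λ p → occurrences 1ℤ (M p)) ⟨
  + ones M                                      ∎
  where
  rowTotal : ∀ p → sum (M p) ≡ + occurrences 1ℤ (M p)
  -- Taking `a` to be 0 makes the two values 0 and 1, so the excess over `a` is the number of ones.
  rowTotal p = trans (occurrences-sum 0ℤ (M p) (binary p))
                     (cong (λ z → z + + occurrences 1ℤ (M p)) (*-zeroʳ (+ v)))

total-rowsOfLayer : ∀ {v} e (M : Array₂ v) → sum (rowSum ∘ rowsOfLayer e M) ≡ total M
total-rowsOfLayer zero       M = refl
total-rowsOfLayer (suc zero) M = sym (∑-comm M)

-- Translates between the two indexings of rows: of the two free coordinates of a layer, `e = zero`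
-- lets the later one vary and `e = suc zero` the earlier one.
rowsOfLayer-row : ∀ {v} (A : Array₃ v) (P : ℤ → Set) → (∀ d p q → P (rowSum (row d A p q))) →
                  ∀ d i e p → P (rowSum (rowsOfLayer e (layer d A i) p))
rowsOfLayer-row A P all zero             i zero       p = all (suc (suc zero)) i p
rowsOfLayer-row A P all zero             i (suc zero) p = all (suc zero) i p
rowsOfLayer-row A P all (suc zero)       i zero       p = all (suc (suc zero)) p i
rowsOfLayer-row A P all (suc zero)       i (suc zero) p = all zero i p
rowsOfLayer-row A P all (suc (suc zero)) i zero       p = all (suc zero) p i
rowsOfLayer-row A P all (suc (suc zero)) i (suc zero) p = all zero p i

-- First and second moments of the row sums.

module Cube {n k λ′} {A : Array₃ (suc n)} (cube : 𝒞³₃ (suc n) k λ′ A) where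
  open 𝒞³₃ cube

  private
    v = suc n

  layer-binary : ∀ d i p q → layer d A i p q ≡ 0ℤ ⊎ layer d A i p q ≡ 1ℤ
  layer-binary zero             i p q = binary i p q
  layer-binary (suc zero)       i p q = binary p i q
  layer-binary (suc (suc zero)) i p q = binary p q i

  layer-total : ∀ d i → total (layer d A i) ≡ + k
  layer-total d i = trans (total≡ones _ (layer-binary d i)) (cong +_ (weight d i))

  -- 0 and 1 are their own squares, so the scalar square of a layer counts its ones.
  layer-self-product : ∀ d i → scalarProduct (layer d A i) (layer d A i) ≡ + k
  layer-self-product d i =
    trans (total-cong λ p q → idempotent (layer-binary d i p q)) (layer-total d i)
    where
    idempotent : ∀ {x} → x ≡ 0ℤ ⊎ x ≡ 1ℤ → x * x ≡ x
    idempotent (inj₁ refl) = refl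
    idempotent (inj₂ refl) = refl

  layer-products : ∀ d i →
    sum (λ j → scalarProduct (layer d A i) (layer d A j)) ≡ + k + (+ v - 1ℤ) * + λ′
  layer-products d i = begin
    sum ⟨Lᵢ,_⟩
      ≡⟨ sum-remove {i = i} ⟨Lᵢ,_⟩ ⟩
    ⟨Lᵢ, i ⟩ + sum (⟨Lᵢ,_⟩ ∘ punchIn i)
      ≡⟨ cong₂ _+_ (layer-self-product d i)
           (sum-cong-≗ λ j → product d i (punchIn i j) (punchInᵢ≢i i j ∘ sym)) ⟩
    + k + sum {n} (λ _ → + λ′)
      -- As `v` is `suc n`, `+ v - 1ℤ` computes to `+ n`, the number of layers parallel to the given
      -- one.
      ≡⟨ cong (λ z → + k + z) (sum-const n (+ λ′)) ⟩
    + k + (+ v - 1ℤ) * + λ′ ∎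
    where
    ⟨Lᵢ,_⟩ : Vector ℤ v
    ⟨Lᵢ, j ⟩ = scalarProduct (layer d A i) (layer d A j)

  -- By computation this array is the entrywise sum of all layers in direction `d`, which is how the
  -- layer conditions reach the row sums.
  rowSums : Fin 3 → Array₂ v
  rowSums d p q = rowSum (row d A p q)

  total-rowSums : ∀ d → total (rowSums d) ≡ + v * + k
  total-rowSums d = begin
    total (rowSums d)               ≡⟨ total-sum (layer d A) ⟩
    sum (λ i → total (layer d A i)) ≡⟨ sum-cong-≗ (layer-total d) ⟩
    sum {v} (λ _ → + k)             ≡⟨ sum-const v (+ k) ⟩
    + v * + k                       ∎

  -- Bilinearity turns the square of the sum of layers into the sum of all entries of their Gram
  -- matrix, each of whose `v` lines has the same sum by `layer-products`.
  rowSums-self-product : ∀ d →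
    scalarProduct (rowSums d) (rowSums d) ≡ + v * (+ k + (+ v - 1ℤ) * + λ′)
  rowSums-self-product d = begin
    scalarProduct (rowSums d) (rowSums d)
      ≡⟨ scalarProduct-sumˡ L (rowSums d) ⟩
    sum (λ i → scalarProduct (L i) (rowSums d))
      ≡⟨ sum-cong-≗ (λ i → scalarProduct-sumʳ (L i) L) ⟩
    sum (λ i → sum λ j → scalarProduct (L i) (L j))
      ≡⟨ sum-cong-≗ (layer-products d) ⟩
    sum {v} (λ _ → + k + (+ v - 1ℤ) * + λ′)
      ≡⟨ sum-const v (+ k + (+ v - 1ℤ) * + λ′) ⟩
    + v * (+ k + (+ v - 1ℤ) * + λ′) ∎
    where
    L = layer d A

  -- The summand is quadratic in the row sum, so the two moments determine the total. The right side
  -- does not depend on `d`.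
  total-deviation : ∀ d f c →
    total (λ p q → (rowSums d p q - f) * (rowSums d p q - c)) ≡
    + v * (+ λ′ * (+ v - 1ℤ) - (+ k * (f + c - 1ℤ) - + v * f * c))
  total-deviation d f c = begin
    total (λ p q → (r p q - f) * (r p q - c))
      ≡⟨ total-cong (λ p q → expand (r p q) f c) ⟩
    total (λ p q → r p q * r p q + - (f + c) * r p q + f * c)
      ≡⟨ sum-cong-≗ (λ p → sum-affine (λ q → r p q * r p q) (r p) (- (f + c)) (f * c)) ⟩
    sum (λ p → sum (λ q → r p q * r p q) + - (f + c) * sum (r p) + + v * (f * c))
      ≡⟨ sum-affine (λ p → sum λ q → r p q * r p q) (λ p → sum (r p)) (- (f + c)) (+ v * (f * c)) ⟩
    scalarProduct r r + - (f + c) * total r + + v * (+ v * (f * c))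
      ≡⟨ cong₂ (λ x y → x + - (f + c) * y + + v * (+ v * (f * c)))
           (rowSums-self-product d) (total-rowSums d) ⟩
    + v * (+ k + (+ v - 1ℤ) * + λ′) + - (f + c) * (+ v * + k) + + v * (+ v * (f * c))
      ≡⟨ collect (+ v) (+ k) (+ λ′) f c ⟩
    + v * (+ λ′ * (+ v - 1ℤ) - (+ k * (f + c - 1ℤ) - + v * f * c)) ∎
    where
    r = rowSums d
    expand : ∀ r f c → (r - f) * (r - c) ≡ r * r + - (f + c) * r + f * c
    expand = solve-∀
    collect : ∀ v k l f c →
      v * (k + (v - 1ℤ) * l) + - (f + c) * (v * k) + v * (v * (f * c)) ≡
      v * (l * (v - 1ℤ) - (k * (f + c - 1ℤ) - v * f * c))
    collect = solve-∀

  -- The inequality, its equality case and the distribution of row sums.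

  module Bound (f : ℤ) where

    private
      c   = f + 1ℤ
      lhs = + λ′ * (+ v - 1ℤ)
      rhs = + k * (f + c - 1ℤ) - + v * f * c

    deviation : Fin 3 → Array₂ v
    deviation d p q = (rowSums d p q - f) * (rowSums d p q - c)

    deviation-nonneg : ∀ d p q → 0ℤ ≤ deviation d p q
    deviation-nonneg d p q =
      -- With `y = r - f` the deviation becomes a product of consecutive integers.
      subst (0ℤ ≤_) (shift (rowSums d p q) f) (consecutive-product-nonneg (rowSums d p q - f))
      where
      shift : ∀ r f → (r - f) * (r - f - 1ℤ) ≡ (r - f) * (r - (f + 1ℤ))
      shift = solve-∀

    total-deviation-nonneg : ∀ d → 0ℤ ≤ total (deviation d)
    total-deviation-nonneg d = sum-nonneg _ λ p → sum-nonneg _ (deviation-nonneg d p)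

    -- The nonnegative total deviation in one direction is `v` times `lhs - rhs`, and the positive
    -- factor `v` cancels.
    bound : lhs ≥ rhs
    bound = 0≤i-j⇒j≤i (*-cancelˡ-≤-pos 0ℤ (lhs - rhs) (+ v)
      (subst (_≤ + v * (lhs - rhs)) (sym (*-zeroʳ (+ v)))
        (subst (0ℤ ≤_) (total-deviation zero f c) (total-deviation-nonneg zero))))

    -- In each direction the total deviation is then 0, so its nonnegative terms all vanish, and the
    -- integers have no zero divisors.
    equality⇒two-valued : lhs ≡ rhs → ∀ d p q → rowSums d p q ≡ f ⊎ rowSums d p q ≡ c
    equality⇒two-valued eq d p q =
      Sum.map (i-j≡0⇒i≡j _ f) (i-j≡0⇒i≡j _ c)
        (i*j≡0⇒i≡0∨j≡0 (rowSums d p q - f) deviation≡0)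
      where
      total≡0 : total (deviation d) ≡ 0ℤ
      total≡0 = trans (total-deviation d f c)
        (trans (cong (+ v *_) (i≡j⇒i-j≡0 eq)) (*-zeroʳ (+ v)))
      deviation≡0 : deviation d p q ≡ 0ℤ
      deviation≡0 = sum≡0⇒≡0 _ (deviation-nonneg d p)
        (sum≡0⇒≡0 _ (λ p → sum-nonneg _ (deviation-nonneg d p)) total≡0 p) q

    two-valued⇒equality : (∀ d p q → rowSums d p q ≡ f ⊎ rowSums d p q ≡ c) → lhs ≡ rhs
    two-valued⇒equality two = i-j≡0⇒i≡j lhs rhs (*-cancelˡ-≡ (+ v) (lhs - rhs) 0ℤ (begin
      + v * (lhs - rhs)         ≡⟨ total-deviation zero f c ⟨
      total (deviation zero)    ≡⟨ total-cong (λ p q → vanish (two zero p q)) ⟩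
      total {v} (λ _ _ → 0ℤ)    ≡⟨ sum-cong-≗ {v} (λ _ → sum-zero) ⟩
      sum {v} (λ _ → 0ℤ)        ≡⟨ sum-zero ⟩
      0ℤ                        ≡⟨ *-zeroʳ (+ v) ⟨
      + v * 0ℤ                  ∎))
      where
      sum-zero : sum {v} (λ _ → 0ℤ) ≡ 0ℤ
      sum-zero = ℤΣ.sum-replicate-zero v
      vanish : ∀ {r} → r ≡ f ⊎ r ≡ c → (r - f) * (r - c) ≡ 0ℤ
      vanish {r} (inj₁ r≡f) = cong (_* (r - c)) (i≡j⇒i-j≡0 r≡f)
      vanish {r} (inj₂ r≡c) = trans (cong ((r - f) *_) (i≡j⇒i-j≡0 r≡c)) (*-zeroʳ (r - f))

    -- The `v` parallel rows partition the layer, so their sums add up to `k`. This and the number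
    -- of rows are two linear equations for the two counts.
    two-valued⇒distribution : (∀ d p q → rowSums d p q ≡ f ⊎ rowSums d p q ≡ c) → ∀ d i e →
      let rs = rowSum ∘ rowsOfLayer e (layer d A i) in
      (+ occurrences f rs ≡ c * + v - + k) × (+ occurrences c rs ≡ + k - f * + v)
    two-valued⇒distribution two d i e = count-f , count-c
      where
      rs = rowSum ∘ rowsOfLayer e (layer d A i)

      rs-two-valued : ∀ p → rs p ≡ f ⊎ rs p ≡ c
      rs-two-valued = rowsOfLayer-row A (λ r → r ≡ f ⊎ r ≡ c) two d i e

      k≡ : + k ≡ + v * f + + occurrences c rs
      k≡ = begin
        + k                               ≡⟨ layer-total d i ⟨
        total (layer d A i)               ≡⟨ total-rowsOfLayer e (layer d A i) ⟨
        sum rs                            ≡⟨ occurrences-sum f rs rs-two-valued ⟩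
        + v * f + + occurrences c rs      ∎

      count-c : + occurrences c rs ≡ + k - f * + v
      count-c = trans (solve-c (+ v) f (+ occurrences c rs)) (cong (_- f * + v) (sym k≡))
        where
        solve-c : ∀ v f o → o ≡ v * f + o - f * v
        solve-c = solve-∀

      count-f : + occurrences f rs ≡ c * + v - + k
      -- Writing both `v` and `k` in terms of the two counts reduces the claim to a polynomial
      -- identity.
      count-f = trans (solve-f f (+ occurrences f rs) (+ occurrences c rs))
        (cong₂ (λ v′ w → c * v′ - w) v≡
          (trans (cong (λ v′ → v′ * f + + occurrences c rs) v≡) (sym k≡)))
        where
        v≡ = occurrences-length f rs rs-two-valued
        solve-f : ∀ f o o′ → o ≡ (f + 1ℤ) * (o + o′) - ((o + o′) * f + o′)
        solve-f = solve-∀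

proposition2p2 : (v k λ′ : ℕ) .{{_ : NonZero v}} (A : Array₃ v) →
    𝒞³₃ v k λ′ A → ¬ (v ∣ k) →
    let f = ⌊ + k / v ⌋
        c = ⌈ + k / v ⌉
        lhs = + λ′ * (+ v - 1ℤ)
        rhs = + k * (f + c - 1ℤ) - + v * f * c
    in
      (lhs ≥ rhs)
      × (lhs ≡ rhs ⇔
          (∀ d p q → rowSum (row d A p q) ≡ f ⊎ rowSum (row d A p q) ≡ c))
      × (lhs ≡ rhs →
          ∀ (d : Fin 3) (i : Fin v) (e : Fin 2) →
          let rowSums = λ p → rowSum (rowsOfLayer e (layer d A i) p) in
            (+ occurrences f rowSums ≡ c * + v - + k)
            × (+ occurrences c rowSums ≡ + k - f * + v))
-- Non-divisibility enters here: the ceiling is rewritten as the floor plus one, the form of `c` in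
-- `Bound`.
proposition2p2 v@(suc _) k λ′ A cube v∤k rewrite ceiling≡floor+1 k v v∤k =
  bound , mk⇔ equality⇒two-valued two-valued⇒equality ,
  two-valued⇒distribution ∘ equality⇒two-valued
  where open Cube.Bound cube ⌊ + k / v ⌋
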